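{- For every formula $F$ of the language of $\mathsf{S4V}^-$: if $\mathsf{S4V}^-\vdash F$ then there is a normal realisation $r$ such that $\mathsf{LPV}^-\vdash F^r$.
   Context: $\mathsf{S4V}^-$: classical modal logic with two unary modalities $\Box$ and ${\bf V}$; axioms: all axioms of $\mathsf{S4}$ for $\Box$, ${\bf V}(A\rightarrow B)\rightarrow({\bf V}A\rightarrow{\bf V}B)$, $\Box A\rightarrow{\bf V}A$; rules: Modus Ponens and $\Box$-Necessitation. $\mathsf{LPV}^-$: language of classical propositional logic extended by ${\bf V}A$ and $t{:}A$, with proof terms built from proof variables and proof constants by binary $\cdot$ (application), $+$ (plus) and unary $!$. Axioms: classical propositional tautologies; $t{:}(A\rightarrow B)\rightarrow(s{:}A\rightarrow (t\cdot s){:}B)$; $t{:}A\rightarrow A$; $t{:}A\rightarrow\, !t{:}t{:}A$; $t{:}A\rightarrow (s+t){:}A$, $t{:}A\rightarrow (t+s){:}A$; ${\bf V}(A\rightarrow B)\rightarrow({\bf V}A\rightarrow {\bf V}B)$; $t{:}A\rightarrow {\bf V}A$. Rules: Modus Ponens and Axiom Necessitation (from an axiom $A$ infer $c{:}A$, $c$ a proof constant). A realisation $r$ of an $\mathsf{S4V}^-$ formula $F$ replaces each occurrence of $\Box$ in $F$ by a proof term (so $\Box G$ becomes $t{:}G^r$), yielding an $\mathsf{LPV}^-$ formula $F^r$. Polarity of occurrences of $\Box$: an occurrence in $F$ keeps its polarity in $G\rightarrow F$, $F\land G$, $G\land F$, $F\lor G$, $G\lor F$, $\Box F$, and reverses it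 in $F\rightarrow G$ and $\neg F$; the outermost occurrence in $\Box G$ as a whole formula is positive. A realisation is normal if every negative occurrence of $\Box$ is replaced by a proof variable. -}

module Defs where

open import Data.Nat using (ℕ)
open import Data.Bool using (Bool; true; false; not; _∧_; _∨_)
open import Data.Product using (Σ; _×_; ∃)
open import Relation.Binary.PropositionalEquality using (_≡_)

infixr 5 _⇒_
infixr 6 _∨ₘ_
infixr 7 _∧ₘ_

data Fm : Set where
  var  : ℕ → Fm
  ⊥ₘ   : Fm
  ¬ₘ_  : Fm → Fm
  _∧ₘ_ : Fm → Fm → Fm
  _∨ₘ_ : Fm → Fm → Fm
  _⇒_  : Fm → Fm → Fm
  □_   : Fm → Fm
  V_   : Fm → Fm

evalM : (Fm → Bool) → Fm → Bool
evalM v (var p)   = v (var p)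
evalM v ⊥ₘ        = false
evalM v (¬ₘ A)    = not (evalM v A)
evalM v (A ∧ₘ B)  = evalM v A ∧ evalM v B
evalM v (A ∨ₘ B)  = evalM v A ∨ evalM v B
evalM v (A ⇒ B)   = not (evalM v A) ∨ evalM v B
evalM v (□ A)     = v (□ A)
evalM v (V A)     = v (V A)

TautM : Fm → Set
TautM A = (v : Fm → Bool) → evalM v A ≡ true

data S4V⊢_ : Fm → Set where
  taut  : ∀ {A} → TautM A → S4V⊢ A
  axK   : ∀ {A B} → S4V⊢ (□ (A ⇒ B) ⇒ (□ A ⇒ □ B))
  axT   : ∀ {A} → S4V⊢ (□ A ⇒ A)
  ax4   : ∀ {A} → S4V⊢ (□ A ⇒ □ □ A)
  axVK  : ∀ {A B} → S4V⊢ (V (A ⇒ B) ⇒ (V A ⇒ V B))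
  ax□V  : ∀ {A} → S4V⊢ (□ A ⇒ V A)
  mp    : ∀ {A B} → S4V⊢ (A ⇒ B) → S4V⊢ A → S4V⊢ B
  nec   : ∀ {A} → S4V⊢ A → S4V⊢ (□ A)

infixl 8 _·_
infixl 7 _+ₜ_

data Tm : Set where
  pvar   : ℕ → Tm
  pconst : ℕ → Tm
  _·_    : Tm → Tm → Tm
  _+ₜ_   : Tm → Tm → Tm
  !_     : Tm → Tm

infixr 5 _⇒ₗ_
infix 9 _∶_

data LFm : Set where
  var  : ℕ → LFm
  ⊥ₗ   : LFm
  ¬ₗ_  : LFm → LFm
  _∧ₗ_ : LFm → LFm → LFm
  _∨ₗ_ : LFm → LFm → LFm
  _⇒ₗ_ : LFm → LFm → LFm
  Vₗ_  : LFm → LFm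
  _∶_  : Tm → LFm → LFm

evalL : (LFm → Bool) → LFm → Bool
evalL v (var p)   = v (var p)
evalL v ⊥ₗ        = false
evalL v (¬ₗ A)    = not (evalL v A)
evalL v (A ∧ₗ B)  = evalL v A ∧ evalL v B
evalL v (A ∨ₗ B)  = evalL v A ∨ evalL v B
evalL v (A ⇒ₗ B)  = not (evalL v A) ∨ evalL v B
evalL v (Vₗ A)    = v (Vₗ A)
evalL v (t ∶ A)   = v (t ∶ A)

TautL : LFm → Set
TautL A = (v : LFm → Bool) → evalL v A ≡ true

data LAx : LFm → Set where
  taut   : ∀ {A} → TautL A → LAx A
  axApp  : ∀ {t s A B} → LAx (t ∶ (A ⇒ₗ B) ⇒ₗ (s ∶ A ⇒ₗ (t · s) ∶ B))
  axRefl : ∀ {t A} → LAx (t ∶ A ⇒ₗ A)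
  axBang : ∀ {t A} → LAx (t ∶ A ⇒ₗ (! t) ∶ (t ∶ A))
  axSumL : ∀ {s t A} → LAx (t ∶ A ⇒ₗ (s +ₜ t) ∶ A)
  axSumR : ∀ {s t A} → LAx (t ∶ A ⇒ₗ (t +ₜ s) ∶ A)
  axVK   : ∀ {A B} → LAx (Vₗ (A ⇒ₗ B) ⇒ₗ (Vₗ A ⇒ₗ Vₗ B))
  axV    : ∀ {t A} → LAx (t ∶ A ⇒ₗ Vₗ A)

data LPV⊢_ : LFm → Set where
  ax    : ∀ {A} → LAx A → LPV⊢ A
  mp    : ∀ {A B} → LPV⊢ (A ⇒ₗ B) → LPV⊢ A → LPV⊢ B
  axnec : ∀ {A} (c : ℕ) → LAx A → LPV⊢ (pconst c ∶ A)

data Realisation : Fm → Set where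
  rvar : ∀ {p} → Realisation (var p)
  r⊥   : Realisation ⊥ₘ
  r¬   : ∀ {A} → Realisation A → Realisation (¬ₘ A)
  r∧   : ∀ {A B} → Realisation A → Realisation B → Realisation (A ∧ₘ B)
  r∨   : ∀ {A B} → Realisation A → Realisation B → Realisation (A ∨ₘ B)
  r⇒   : ∀ {A B} → Realisation A → Realisation B → Realisation (A ⇒ B)
  rV   : ∀ {A} → Realisation A → Realisation (V A)
  r□   : ∀ {A} → Tm → Realisation A → Realisation (□ A)

_^_ : (F : Fm) → Realisation F → LFm
var p ^ rvar        = var p
⊥ₘ ^ r⊥             = ⊥ₗ
(¬ₘ A) ^ r¬ r       = ¬ₗ (A ^ r)
(A ∧ₘ B) ^ r∧ r s   = (A ^ r) ∧ₗ (B ^ s)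
(A ∨ₘ B) ^ r∨ r s   = (A ^ r) ∨ₗ (B ^ s)
(A ⇒ B) ^ r⇒ r s    = (A ^ r) ⇒ₗ (B ^ s)
(V A) ^ rV r        = Vₗ (A ^ r)
(□ A) ^ r□ t r      = t ∶ (A ^ r)

data Polarity : Set where
  pos neg : Polarity

flip : Polarity → Polarity
flip pos = neg
flip neg = pos

data IsProofVar : Tm → Set where
  isVar : ∀ x → IsProofVar (pvar x)

data NormalAt : ∀ {F} → Polarity → Realisation F → Set where
  nvar : ∀ {p q} → NormalAt {var q} p rvar
  n⊥   : ∀ {p} → NormalAt p r⊥
  n¬   : ∀ {p A} {r : Realisation A} → NormalAt (flip p) r → NormalAt p (r¬ r)
  n∧   : ∀ {p A B} {r : Realisation A} {s : Realisation B} →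
         NormalAt p r → NormalAt p s → NormalAt p (r∧ r s)
  n∨   : ∀ {p A B} {r : Realisation A} {s : Realisation B} →
         NormalAt p r → NormalAt p s → NormalAt p (r∨ r s)
  n⇒   : ∀ {p A B} {r : Realisation A} {s : Realisation B} →
         NormalAt (flip p) r → NormalAt p s → NormalAt p (r⇒ r s)
  nV   : ∀ {p A} {r : Realisation A} → NormalAt p r → NormalAt p (rV r)
  n□+  : ∀ {A t} {r : Realisation A} → NormalAt pos r → NormalAt pos (r□ t r)
  n□-  : ∀ {A t} {r : Realisation A} → IsProofVar t → NormalAt neg r →
         NormalAt neg (r□ t r)

Normal : ∀ {F} → Realisation F → Set
Normal r = NormalAt pos r

-- S4V⁻ is complete for a cut-free calculus of signed formulas.  Completeness is
-- a Kripke-style argument whose worlds are finite lists of signed formulas, with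
-- falsity at a world read as "the world is refuted by the calculus"; hence it is
-- constructive and yields an actual cut-free refutation.
--
-- A cut-free refutation never connects a negative □ with a positive one, so it
-- can be realised by replacing all negative boxes with a single variable, all
-- positive boxes with a single term U, and by using a single constant for all
-- axioms.  The terms that internalise the steps of the refutation then depend
-- only on its shape and not on U, so U may be taken to be the sum of all of them.
module Submission where

open import Defs
open import Data.Bool using (Bool; true; false; not; _∧_; _∨_)
open import Data.List using (List; []; _∷_; [_]; _++_; map)
open import Data.List.Membership.Propositional using (_∈_)
open import Data.List.Membership.Propositional.Properties using (∈-map⁺)
open import Data.List.Relation.Binary.Subset.Propositional using (_⊆_)
open import Data.List.Relation.Binary.Subset.Propositional.Properties using (⊆-refl; ⊆-trans; xs⊆x∷xs)
open import Data.List.Relation.Unary.All as All using (All; []; _∷_)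
open import Data.List.Relation.Unary.All.Properties using (++⁻)
open import Data.List.Relation.Unary.Any using (here; there)
open import Data.Maybe as Maybe using (Maybe; just; nothing; zipWith)
open import Data.Nat using (_≟_)
open import Data.Nat.Properties using (≟-diag)
open import Data.Product using (Σ; ∃; _×_; _,_; proj₁; proj₂)
open import Data.Unit using (⊤; tt)
open import Relation.Binary.PropositionalEquality using (_≡_; refl; sym; trans; cong; cong₂)
open import Relation.Nullary using (yes; no)

-- The cut-free calculus

data SFm : Set where
  T F : Fm → SFm

data Modality : Set where
  box ver : Modality

mod : Modality → Fm → Fm
mod box A = □ A
mod ver A = V A

data Alpha : SFm → SFm → Set where
  T¬  : ∀ {A} → Alpha (T (¬ₘ A)) (F A)
  F¬  : ∀ {A} → Alpha (F (¬ₘ A)) (T A)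
  T∧ˡ : ∀ {A B} → Alpha (T (A ∧ₘ B)) (T A)
  T∧ʳ : ∀ {A B} → Alpha (T (A ∧ₘ B)) (T B)
  F∨ˡ : ∀ {A B} → Alpha (F (A ∨ₘ B)) (F A)
  F∨ʳ : ∀ {A B} → Alpha (F (A ∨ₘ B)) (F B)
  F⇒ˡ : ∀ {A B} → Alpha (F (A ⇒ B)) (T A)
  F⇒ʳ : ∀ {A B} → Alpha (F (A ⇒ B)) (F B)
  T□  : ∀ {A} → Alpha (T (□ A)) (T A)

data Beta : SFm → SFm → SFm → Set where
  F∧ : ∀ {A B} → Beta (F (A ∧ₘ B)) (F A) (F B)
  T∨ : ∀ {A B} → Beta (T (A ∨ₘ B)) (T A) (T B)
  T⇒ : ∀ {A B} → Beta (T (A ⇒ B)) (F A) (T B)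

-- Transfer m φ ψ: a world containing φ sees along m only worlds containing ψ.
data Transfer : Modality → SFm → SFm → Set where
  keep   : ∀ {m A} → Transfer m (T (□ A)) (T (□ A))
  unwrap : ∀ {A} → Transfer ver (T (V A)) (T A)

TransferredFrom : Modality → List SFm → SFm → Set
TransferredFrom m S ψ = ∃ λ φ → φ ∈ S × Transfer m φ ψ

-- Lists act as sets: premises keep the principal formula, so contraction is built in. Only `modal`
-- discards formulas.
data Closed (S : List SFm) : Set where
  init  : ∀ {p} → T (var p) ∈ S → F (var p) ∈ S → Closed S
  bot   : T ⊥ₘ ∈ S → Closed S
  alpha : ∀ {φ ψ} → Alpha φ ψ → φ ∈ S → Closed (ψ ∷ S) → Closed S
  beta  : ∀ {φ ψ χ} → Beta φ ψ χ → φ ∈ S → Closed (ψ ∷ S) → Closed (χ ∷ S) → Closed S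
  modal : ∀ {A S′} m → F (mod m A) ∈ S → All (TransferredFrom m S) S′ →
          Closed (F A ∷ S′) → Closed S

transfer? : ∀ m φ → Maybe (∃ (Transfer m φ))
transfer? m   (T (□ A)) = just (T (□ A) , keep)
transfer? ver (T (V A)) = just (T A , unwrap)
transfer? _   _         = nothing

transfer?-complete : ∀ {m φ ψ} (τ : Transfer m φ ψ) → transfer? m φ ≡ just (ψ , τ)
transfer?-complete {box} keep = refl
transfer?-complete {ver} keep = refl
transfer?-complete unwrap     = refl

infix 4 _⟨_⟩_
_⟨_⟩_ : List SFm → Modality → List SFm → Set
S ⟨ m ⟩ S′ = ∀ {φ ψ} → φ ∈ S → Transfer m φ ψ → ψ ∈ S′

later : ∀ {m φ S ψ} → TransferredFrom m S ψ → TransferredFrom m (φ ∷ S) ψ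
later (χ , χ∈ , τ) = χ , there χ∈ , τ

-- Each signed formula transfers to at most one formula along `m`, so the transferred ones form a
-- finite list, which is both an accessible world and a legal premise of `modal`.
least-successor : ∀ m S → ∃ λ S′ → All (TransferredFrom m S) S′ × S ⟨ m ⟩ S′
least-successor m [] = [] , [] , λ ()
least-successor m (φ ∷ S) with least-successor m S | transfer? m φ in eq
... | S′ , from , to | nothing = S′ , All.map later from , to′
  where
  to′ : (φ ∷ S) ⟨ m ⟩ S′
  to′ (there χ∈) τ = to χ∈ τ
  to′ (here refl) τ with () ← trans (sym eq) (transfer?-complete τ)
... | S′ , from , to | just (ψ , σ) = ψ ∷ S′ , (φ , here refl , σ) ∷ All.map later from , to′
  where
  to′ : (φ ∷ S) ⟨ m ⟩ (ψ ∷ S′)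
  to′ (there χ∈) τ = there (to χ∈ τ)
  to′ (here refl) τ with refl ← trans (sym eq) (transfer?-complete τ) = here refl

-- Completeness of the cut-free calculus

-- Kripke negation over worlds ordered by inclusion, with `Closed` as falsity.
Neg : (List SFm → Set) → List SFm → Set
Neg X S = ∀ {S′} → S ⊆ S′ → X S′ → Closed S′

Neg-mono : ∀ {X S S′} → S ⊆ S′ → Neg X S → Neg X S′
Neg-mono S⊆S′ n S′⊆S″ = n (⊆-trans S⊆S′ S′⊆S″)

Nec : Modality → (List SFm → Set) → List SFm → Set
Nec m X S = ∀ {S′} → S ⟨ m ⟩ S′ → X S′

-- Truth is defined as the negation of refutation so that every formula is
-- interpreted by a predicate stable under Neg ∘ Neg.
Refutes : Fm → List SFm → Set

Forces : Fm → List SFm → Set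
Forces A = Neg (Refutes A)

Refutes (var p)  S = F (var p) ∈ S
Refutes ⊥ₘ       S = ⊤
Refutes (¬ₘ A)   S = Neg (Refutes A) S
Refutes (A ∧ₘ B) S = Neg (λ S′ → Neg (Refutes A) S′ × Neg (Refutes B) S′) S
Refutes (A ∨ₘ B) S = Neg (Neg (Refutes A)) S × Neg (Neg (Refutes B)) S
Refutes (A ⇒ B)  S = Neg (Refutes A) S × Neg (Neg (Refutes B)) S
Refutes (□ A)    S = Neg (Nec box (Neg (Refutes A))) S
Refutes (V A)    S = Neg (Nec ver (Neg (Refutes A))) S

Refutes-mono : ∀ A {S S′} → S ⊆ S′ → Refutes A S → Refutes A S′
Refutes-mono (var p)  S⊆ r       = S⊆ r
Refutes-mono ⊥ₘ       S⊆ r       = tt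
Refutes-mono (¬ₘ A)   S⊆ r       = Neg-mono S⊆ r
Refutes-mono (A ∧ₘ B) S⊆ r       = Neg-mono S⊆ r
Refutes-mono (A ∨ₘ B) S⊆ (r , s) = Neg-mono S⊆ r , Neg-mono S⊆ s
Refutes-mono (A ⇒ B)  S⊆ (r , s) = Neg-mono S⊆ r , Neg-mono S⊆ s
Refutes-mono (□ A)    S⊆ r       = Neg-mono S⊆ r
Refutes-mono (V A)    S⊆ r       = Neg-mono S⊆ r

Forces-⇒ : ∀ A B {S} → (∀ {S′} → S ⊆ S′ → Forces A S′ → Forces B S′) → Forces (A ⇒ B) S
Forces-⇒ A B f S⊆ (a , ¬b) = ¬b ⊆-refl (f S⊆ a)

Forces-mp : ∀ A B {S} → Forces (A ⇒ B) S → Forces A S → Forces B S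
Forces-mp A B f a S⊆ rb =
  f S⊆ (Neg-mono S⊆ a , λ S′⊆ b → b ⊆-refl (Refutes-mono B S′⊆ rb))

mutual
  -- Truth lemma, proved together with `F-refutes`: each connective uses the calculus rule for its
  -- sign.
  T-forces : ∀ A {S} → T A ∈ S → Forces A S
  T-forces (var p)  ∈S S⊆ r = init (S⊆ ∈S) r
  T-forces ⊥ₘ       ∈S S⊆ r = bot (S⊆ ∈S)
  T-forces (¬ₘ A)   ∈S S⊆ r = alpha T¬ (S⊆ ∈S) (close-F A r)
  T-forces (A ∧ₘ B) ∈S S⊆ r =
    r ⊆-refl ( unfold-forces A (λ S′⊆ → alpha T∧ˡ (S′⊆ (S⊆ ∈S)))
             , unfold-forces B (λ S′⊆ → alpha T∧ʳ (S′⊆ (S⊆ ∈S))))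
  T-forces (A ∨ₘ B) ∈S S⊆ (r , s) = beta T∨ (S⊆ ∈S) (close-T A r) (close-T B s)
  T-forces (A ⇒ B)  ∈S S⊆ (r , s) = beta T⇒ (S⊆ ∈S) (close-F A r) (close-T B s)
  T-forces (□ A)    ∈S S⊆ r =
    r ⊆-refl (λ to → unfold-forces A (λ S′⊆ → alpha T□ (S′⊆ (to (S⊆ ∈S) keep))))
  T-forces (V A)    ∈S S⊆ r = r ⊆-refl (λ to → T-forces A (to (S⊆ ∈S) unwrap))

  F-refutes : ∀ A {S} → F A ∈ S → Refutes A S
  F-refutes (var p)  ∈S = ∈S
  F-refutes ⊥ₘ       ∈S = tt
  F-refutes (¬ₘ A)   ∈S = unfold-forces A (λ S⊆ → alpha F¬ (S⊆ ∈S))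
  F-refutes (A ∧ₘ B) ∈S S⊆ (a , b) = beta F∧ (S⊆ ∈S) (close-F A a) (close-F B b)
  F-refutes (A ∨ₘ B) ∈S = (λ S⊆ a → alpha F∨ˡ (S⊆ ∈S) (close-F A a))
                        , (λ S⊆ b → alpha F∨ʳ (S⊆ ∈S) (close-F B b))
  F-refutes (A ⇒ B)  ∈S = unfold-forces A (λ S⊆ → alpha F⇒ˡ (S⊆ ∈S))
                        , (λ S⊆ b → alpha F⇒ʳ (S⊆ ∈S) (close-F B b))
  F-refutes (□ A)    ∈S S⊆ n = close-modal box A (S⊆ ∈S) n
  F-refutes (V A)    ∈S S⊆ n = close-modal ver A (S⊆ ∈S) n

  close-T : ∀ A {S} → Neg (Forces A) S → Closed (T A ∷ S)
  close-T A n = n (xs⊆x∷xs _ _) (T-forces A (here refl))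

  close-F : ∀ A {S} → Forces A S → Closed (F A ∷ S)
  close-F A a = a (xs⊆x∷xs _ _) (F-refutes A (here refl))

  close-modal : ∀ m A {S} → F (mod m A) ∈ S → Nec m (Forces A) S → Closed S
  close-modal m A {S} ∈S n with least-successor m S
  ... | S′ , from , to = modal m ∈S from (close-F A (n to))

  -- If a rule lets `T A` be added to any extension, `A` is forced even where `T A` is absent: once
  -- added, it clashes with any refutation of `A`.
  unfold-forces : ∀ A {S} → (∀ {S′} → S ⊆ S′ → Closed (T A ∷ S′) → Closed S′) → Forces A S
  unfold-forces A f S⊆ r =
    f S⊆ (T-forces A (here refl) ⊆-refl (Refutes-mono A (xs⊆x∷xs _ _) r))

-- Classical tautologies are forced

-- Answering with Maybe rather than Dec avoids the off-diagonal refutations.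
same : (A B : Fm) → Maybe (A ≡ B)
same (var p) (var q) with p ≟ q
... | yes p≡q = just (cong var p≡q)
... | no _    = nothing
same ⊥ₘ       ⊥ₘ       = just refl
same (¬ₘ A)   (¬ₘ B)   = Maybe.map (cong ¬ₘ_) (same A B)
same (A ∧ₘ B) (C ∧ₘ D) = zipWith (cong₂ _∧ₘ_) (same A C) (same B D)
same (A ∨ₘ B) (C ∨ₘ D) = zipWith (cong₂ _∨ₘ_) (same A C) (same B D)
same (A ⇒ B)  (C ⇒ D)  = zipWith (cong₂ _⇒_) (same A C) (same B D)
same (□ A)    (□ B)    = Maybe.map (cong □_) (same A B)
same (V A)    (V B)    = Maybe.map (cong V_) (same A B)
same _        _        = nothing

same-refl : ∀ A → same A A ≡ just refl
same-refl (var p) rewrite ≟-diag {p} refl = refl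
same-refl ⊥ₘ = refl
same-refl (¬ₘ A)   rewrite same-refl A = refl
same-refl (A ∧ₘ B) rewrite same-refl A | same-refl B = refl
same-refl (A ∨ₘ B) rewrite same-refl A | same-refl B = refl
same-refl (A ⇒ B)  rewrite same-refl A | same-refl B = refl
same-refl (□ A)    rewrite same-refl A = refl
same-refl (V A)    rewrite same-refl A = refl

update : (Fm → Bool) → Fm → Bool → Fm → Bool
update v A b B with same A B
... | just _  = b
... | nothing = v B

Decided : Bool → Fm → List SFm → Set
Decided true  A = Forces A
Decided false A = Neg (Forces A)

Decided-mono : ∀ b A {S S′} → S ⊆ S′ → Decided b A S → Decided b A S′
Decided-mono true  A = Neg-mono
Decided-mono false A = Neg-mono

update-same : ∀ v A b {S} → Decided b A S → Decided (update v A b A) A S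
update-same v A b d rewrite same-refl A = d

-- `B` may be a repeated occurrence of `A`; the new decision then replaces the old one.
update-other : ∀ v A b B {S} → Decided b A S → Decided (v B) B S → Decided (update v A b B) B S
update-other v A b B d e with same A B
... | just refl = d
... | nothing   = e

-- The goal `Closed` serves as falsity, and excluded middle for finitely many formulas is
-- irrefutable, so a valuation of `As` may be assumed.
classical-valuation : ∀ As {S} →
  (∀ {S′} → S ⊆ S′ → ∀ v → All (λ A → Decided (v A) A S′) As → Closed S′) → Closed S
classical-valuation []       k = k ⊆-refl (λ _ → false) []
classical-valuation (A ∷ As) k = classical-valuation As λ S⊆ v ds →
  let decide : ∀ b {S′} → _ ⊆ S′ → Decided b A S′ → Closed S′
      decide b S′⊆ d = k (⊆-trans S⊆ S′⊆) (update v A b)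
        (update-same v A b d ∷
         All.map (λ {B} e → update-other v A b B d (Decided-mono (v B) B S′⊆ e)) ds)
  -- Closing every extension that forces `A` is exactly `Neg (Forces A)`, which is what the false
  -- case asks for.
  in decide false ⊆-refl (decide true)

atoms : Fm → List Fm
atoms (var p)  = [ var p ]
atoms ⊥ₘ       = []
atoms (¬ₘ A)   = atoms A
atoms (A ∧ₘ B) = atoms A ++ atoms B
atoms (A ∨ₘ B) = atoms A ++ atoms B
atoms (A ⇒ B)  = atoms A ++ atoms B
atoms (□ A)    = [ □ A ]
atoms (V A)    = [ V A ]

module _ {S : List SFm} where

  Decided-¬ : ∀ a {A} → Decided a A S → Decided (not a) (¬ₘ A) S
  Decided-¬ true  d = λ S⊆ n → n ⊆-refl (Neg-mono S⊆ d)
  Decided-¬ false d = d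

  Decided-∧ : ∀ a b {A B} → Decided a A S → Decided b B S → Decided (a ∧ b) (A ∧ₘ B) S
  Decided-∧ true  true  d e = λ S⊆ n → n ⊆-refl (Neg-mono S⊆ d , Neg-mono S⊆ e)
  Decided-∧ true  false d e = λ S⊆ f → f ⊆-refl (λ S′⊆ ab → e (⊆-trans S⊆ S′⊆) (proj₂ ab))
  Decided-∧ false b     d e = λ S⊆ f → f ⊆-refl (λ S′⊆ ab → d (⊆-trans S⊆ S′⊆) (proj₁ ab))

  Decided-∨ : ∀ a b {A B} → Decided a A S → Decided b B S → Decided (a ∨ b) (A ∨ₘ B) S
  Decided-∨ true  b     d e = λ S⊆ n → proj₁ n ⊆-refl (Neg-mono S⊆ d)
  Decided-∨ false true  d e = λ S⊆ n → proj₂ n ⊆-refl (Neg-mono S⊆ e)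
  Decided-∨ false false d e = λ S⊆ f → f ⊆-refl (Neg-mono S⊆ d , Neg-mono S⊆ e)

  Decided-⇒ : ∀ a b {A B} → Decided a A S → Decided b B S → Decided (not a ∨ b) (A ⇒ B) S
  Decided-⇒ true  true  d e = λ S⊆ n → proj₂ n ⊆-refl (Neg-mono S⊆ e)
  Decided-⇒ true  false d e = λ S⊆ f → f ⊆-refl (Neg-mono S⊆ d , Neg-mono S⊆ e)
  Decided-⇒ false b     d e = λ S⊆ n → d S⊆ (proj₁ n)

  Decided-eval : ∀ v A → All (λ B → Decided (v B) B S) (atoms A) → Decided (evalM v A) A S
  Decided-eval v (var p)  (d ∷ _) = d
  Decided-eval v ⊥ₘ       ds = λ S⊆ f → f ⊆-refl tt
  Decided-eval v (¬ₘ A)   ds = Decided-¬ (evalM v A) (Decided-eval v A ds)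
  Decided-eval v (A ∧ₘ B) ds with ++⁻ (atoms A) ds
  ... | ds₁ , ds₂ = Decided-∧ (evalM v A) (evalM v B) (Decided-eval v A ds₁) (Decided-eval v B ds₂)
  Decided-eval v (A ∨ₘ B) ds with ++⁻ (atoms A) ds
  ... | ds₁ , ds₂ = Decided-∨ (evalM v A) (evalM v B) (Decided-eval v A ds₁) (Decided-eval v B ds₂)
  Decided-eval v (A ⇒ B)  ds with ++⁻ (atoms A) ds
  ... | ds₁ , ds₂ = Decided-⇒ (evalM v A) (evalM v B) (Decided-eval v A ds₁) (Decided-eval v B ds₂)
  Decided-eval v (□ A)    (d ∷ _) = d
  Decided-eval v (V A)    (d ∷ _) = d

Forces-taut : ∀ A → TautM A → ∀ {S} → Forces A S
Forces-taut A τ S⊆ r = classical-valuation (atoms A) λ S′⊆ v ds →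
  forced (τ v) (Decided-eval v A ds) ⊆-refl (Refutes-mono A S′⊆ r)
  where
  forced : ∀ {b S} → b ≡ true → Decided b A S → Forces A S
  forced refl d = d

-- Soundness: frame conditions and axioms

refl-box : ∀ {S} → S ⟨ box ⟩ S
refl-box ∈S keep = ∈S

⟨⟩-⊆ : ∀ {m S S′ S″} → S ⊆ S′ → S′ ⟨ m ⟩ S″ → S ⟨ m ⟩ S″
⟨⟩-⊆ S⊆ to ∈S = to (S⊆ ∈S)

-- Boxed formulas survive steps of either modality; for `box` this is the transitivity behind `ax4`.
box-⟨⟩ : ∀ {m S S′ S″} → S ⟨ box ⟩ S′ → S′ ⟨ m ⟩ S″ → S ⟨ box ⟩ S″
box-⟨⟩ to to′ ∈S keep = to′ (to ∈S keep) keep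

ver⊆box : ∀ {S S′} → S ⟨ ver ⟩ S′ → S ⟨ box ⟩ S′
ver⊆box to ∈S keep = to ∈S keep

NecForces : Modality → Fm → List SFm → Set
NecForces m A = Nec m (Forces A)

Nec-K : ∀ m A B {S} → Neg (Neg (NecForces m (A ⇒ B))) S → Neg (Neg (NecForces m A)) S →
  Neg (Neg (NecForces m B)) S
Nec-K m A B f a S⊆ n = f S⊆ λ S′⊆ f′ → a (⊆-trans S⊆ S′⊆) λ S″⊆ a′ →
  n (⊆-trans S′⊆ S″⊆) λ to → Forces-mp A B (f′ (⟨⟩-⊆ S″⊆ to)) (a′ to)

sound : ∀ {A} → S4V⊢ A → ∀ {S} → Forces A S
sound (taut τ) = Forces-taut _ τ
sound (axK {A} {B}) = Forces-⇒ (□ (A ⇒ B)) (□ A ⇒ □ B) λ _ f →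
  Forces-⇒ (□ A) (□ B) λ S⊆ a → Nec-K box A B (Neg-mono S⊆ f) a
sound (axVK {A} {B}) = Forces-⇒ (V (A ⇒ B)) (V A ⇒ V B) λ _ f →
  Forces-⇒ (V A) (V B) λ S⊆ a → Nec-K ver A B (Neg-mono S⊆ f) a
sound (axT {A}) = Forces-⇒ (□ A) A λ _ a S⊆ r →
  a S⊆ λ S′⊆ a′ → a′ refl-box ⊆-refl (Refutes-mono A S′⊆ r)
sound (ax4 {A}) = Forces-⇒ (□ A) (□ □ A) λ _ a S⊆ n → a S⊆ λ S′⊆ a′ → n S′⊆ λ to S″⊆ n′ →
  n′ ⊆-refl λ to′ → a′ (box-⟨⟩ to (⟨⟩-⊆ S″⊆ to′))
sound (ax□V {A}) = Forces-⇒ (□ A) (V A) λ _ a S⊆ n → a S⊆ λ S′⊆ a′ → n S′⊆ λ to → a′ (ver⊆box to)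
sound (mp {A} {B} d e) = Forces-mp A B (sound d) (sound e)
sound (nec d)  = λ _ n → n ⊆-refl λ _ → sound d

-- At the world `[ F A ]` the formula is forced by soundness and refuted by the truth lemma.
cut-free : ∀ {A} → S4V⊢ A → Closed [ F A ]
cut-free d = sound d ⊆-refl (F-refutes _ (here refl))

-- Internalised reasoning in LPV⁻

-- Truth-table check: for a concrete `f` the hypothesis computes to `refl`.
forall₁ : ∀ (f : Bool → Bool) → f true ∧ f false ≡ true → ∀ a → f a ≡ true
forall₁ f eq true  with f true | eq
... | true | _ = refl
forall₁ f eq false with f true | eq
... | true | eq′ = eq′

forall₂ : ∀ (f : Bool → Bool → Bool) →
  (f true true ∧ f true false) ∧ (f false true ∧ f false false) ≡ true → ∀ a b → f a b ≡ true
forall₂ f eq a b = forall₁ (f a) (forall₁ (λ a → f a true ∧ f a false) eq a) b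

∨-not⁺ : ∀ a {b} → (a ≡ true → b ≡ true) → not a ∨ b ≡ true
∨-not⁺ true  f = f refl
∨-not⁺ false f = refl

∨-not⁻ : ∀ a {b} → not a ∨ b ≡ true → a ≡ true → b ≡ true
∨-not⁻ true eq refl = eq

-- The hypotheses are accumulated so that  (A ∷ Γ) ⟶ B  unfolds to  Γ ⟶ (A ⇒ₗ B).
infix 4 _⟶_
_⟶_ : List LFm → LFm → LFm
[]      ⟶ B = B
(A ∷ Γ) ⟶ B = Γ ⟶ (A ⇒ₗ B)

module _ (v : LFm → Bool) where

  True : LFm → Set
  True A = evalL v A ≡ true

  ⟶⁺ : ∀ Γ {B} → (All True Γ → True B) → True (Γ ⟶ B)
  ⟶⁺ []      f = f []
  ⟶⁺ (A ∷ Γ) f = ⟶⁺ Γ λ as → ∨-not⁺ (evalL v A) λ a → f (a ∷ as)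

  ⟶⁻ : ∀ Γ {B} → True (Γ ⟶ B) → All True Γ → True B
  ⟶⁻ []      b []       = b
  ⟶⁻ (A ∷ Γ) b (a ∷ as) = ∨-not⁻ (evalL v A) (⟶⁻ Γ b as) a

c : Tm
c = pconst 0

app : ∀ {t s A B} → LPV⊢ (t ∶ (A ⇒ₗ B)) → LPV⊢ (s ∶ A) → LPV⊢ ((t · s) ∶ B)
app d e = mp (mp (ax axApp) d) e

infix 4 _⊢_∶_
-- The term proves the whole implication. In the rules below it is built from the premise terms
-- alone, independently of `Γ` and the formulas.
record _⊢_∶_ (Γ : List LFm) (t : Tm) (B : LFm) : Set where
  constructor internal
  field theorem : LPV⊢ (t ∶ (Γ ⟶ B))
open _⊢_∶_

deduction : ∀ {Γ t A B} → (A ∷ Γ) ⊢ t ∶ B → Γ ⊢ t ∶ (A ⇒ₗ B)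
deduction (internal d) = internal d

module _ {Γ : List LFm} where

  hyp : ∀ {B} → B ∈ Γ → Γ ⊢ c ∶ B
  hyp B∈ = internal (axnec 0 (taut λ v → ⟶⁺ v Γ λ as → All.lookup as B∈))

  weaken : ∀ {t B} → LPV⊢ (t ∶ B) → Γ ⊢ c · t ∶ B
  weaken {B = B} d = internal
    (app (axnec 0 (taut λ v → ∨-not⁺ (evalL v B) λ b → ⟶⁺ v Γ λ _ → b)) d)

  axiomΓ : ∀ {B} → LAx B → Γ ⊢ c · c ∶ B
  axiomΓ a = weaken (axnec 0 a)

  infixl 5 _∙_
  _∙_ : ∀ {t s A B} → Γ ⊢ t ∶ (A ⇒ₗ B) → Γ ⊢ s ∶ A → Γ ⊢ c · t · s ∶ B
  _∙_ {A = A} {B} (internal d) (internal e) = internal (app (app (axnec 0 (taut distributes)) d) e)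
    where
    distributes : TautL ((Γ ⟶ (A ⇒ₗ B)) ⇒ₗ ((Γ ⟶ A) ⇒ₗ (Γ ⟶ B)))
    distributes v = ∨-not⁺ (evalL v (Γ ⟶ (A ⇒ₗ B))) λ f → ∨-not⁺ (evalL v (Γ ⟶ A)) λ a →
      ⟶⁺ v Γ λ as → ∨-not⁻ (evalL v A) (⟶⁻ v Γ f as) (⟶⁻ v Γ a as)

-- Realisation of cut-free refutations

annotation : Tm → Polarity → Tm
annotation U pos = U
annotation U neg = pvar 0

realise : Tm → Polarity → ∀ A → Realisation A
realise U p (var q)  = rvar
realise U p ⊥ₘ       = r⊥
realise U p (¬ₘ A)   = r¬ (realise U (flip p) A)
realise U p (A ∧ₘ B) = r∧ (realise U p A) (realise U p B)
realise U p (A ∨ₘ B) = r∨ (realise U p A) (realise U p B)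
realise U p (A ⇒ B)  = r⇒ (realise U (flip p) A) (realise U p B)
realise U p (□ A)    = r□ (annotation U p) (realise U p A)
realise U p (V A)    = rV (realise U p A)

realise-normal : ∀ U p A → NormalAt p (realise U p A)
realise-normal U p   (var q)  = nvar
realise-normal U p   ⊥ₘ       = n⊥
realise-normal U p   (¬ₘ A)   = n¬ (realise-normal U (flip p) A)
realise-normal U p   (A ∧ₘ B) = n∧ (realise-normal U p A) (realise-normal U p B)
realise-normal U p   (A ∨ₘ B) = n∨ (realise-normal U p A) (realise-normal U p B)
realise-normal U p   (A ⇒ B)  = n⇒ (realise-normal U (flip p) A) (realise-normal U p B)
realise-normal U pos (□ A)    = n□+ (realise-normal U pos A)
realise-normal U neg (□ A)    = n□- (isVar 0) (realise-normal U neg A)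
realise-normal U p   (V A)    = nV (realise-normal U p A)

⌈_⌉ : Fm → Polarity → Tm → LFm
⌈ A ⌉ p U = A ^ realise U p A

signed : Tm → SFm → LFm
signed U (T A) = ⌈ A ⌉ neg U
signed U (F A) = ⌈ A ⌉ pos U ⇒ₗ ⊥ₗ

-- The sign of a formula fixes its polarity, and the rules respect it, so a subformula is realised
-- identically before and after the rule.
alpha-axiom : ∀ {φ ψ} U → Alpha φ ψ → LAx (signed U φ ⇒ₗ signed U ψ)
alpha-axiom U (T¬ {A}) =
  taut λ v → forall₁ (λ a → not (not a) ∨ (not a ∨ false)) refl (evalL v (⌈ A ⌉ pos U))
alpha-axiom U (F¬ {A}) =
  taut λ v → forall₁ (λ a → not (not (not a) ∨ false) ∨ a) refl (evalL v (⌈ A ⌉ neg U))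
alpha-axiom U (T∧ˡ {A} {B}) = taut λ v →
  forall₂ (λ a b → not (a ∧ b) ∨ a) refl (evalL v (⌈ A ⌉ neg U)) (evalL v (⌈ B ⌉ neg U))
alpha-axiom U (T∧ʳ {A} {B}) = taut λ v →
  forall₂ (λ a b → not (a ∧ b) ∨ b) refl (evalL v (⌈ A ⌉ neg U)) (evalL v (⌈ B ⌉ neg U))
alpha-axiom U (F∨ˡ {A} {B}) = taut λ v →
  forall₂ (λ a b → not (not (a ∨ b) ∨ false) ∨ (not a ∨ false)) refl
    (evalL v (⌈ A ⌉ pos U)) (evalL v (⌈ B ⌉ pos U))
alpha-axiom U (F∨ʳ {A} {B}) = taut λ v →
  forall₂ (λ a b → not (not (a ∨ b) ∨ false) ∨ (not b ∨ false)) refl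
    (evalL v (⌈ A ⌉ pos U)) (evalL v (⌈ B ⌉ pos U))
alpha-axiom U (F⇒ˡ {A} {B}) = taut λ v →
  forall₂ (λ a b → not (not (not a ∨ b) ∨ false) ∨ a) refl
    (evalL v (⌈ A ⌉ neg U)) (evalL v (⌈ B ⌉ pos U))
alpha-axiom U (F⇒ʳ {A} {B}) = taut λ v →
  forall₂ (λ a b → not (not (not a ∨ b) ∨ false) ∨ (not b ∨ false)) refl
    (evalL v (⌈ A ⌉ neg U)) (evalL v (⌈ B ⌉ pos U))
alpha-axiom U T□ = axRefl

beta-axiom : ∀ {φ ψ χ} U → Beta φ ψ χ →
  LAx (signed U φ ⇒ₗ ((signed U ψ ⇒ₗ ⊥ₗ) ⇒ₗ ((signed U χ ⇒ₗ ⊥ₗ) ⇒ₗ ⊥ₗ)))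
beta-axiom U (F∧ {A} {B}) = taut λ v →
  forall₂ (λ a b → not (not (a ∧ b) ∨ false) ∨
             (not (not (not a ∨ false) ∨ false) ∨ (not (not (not b ∨ false) ∨ false) ∨ false)))
    refl (evalL v (⌈ A ⌉ pos U)) (evalL v (⌈ B ⌉ pos U))
beta-axiom U (T∨ {A} {B}) = taut λ v →
  forall₂ (λ a b → not (a ∨ b) ∨ (not (not a ∨ false) ∨ (not (not b ∨ false) ∨ false)))
    refl (evalL v (⌈ A ⌉ neg U)) (evalL v (⌈ B ⌉ neg U))
beta-axiom U (T⇒ {A} {B}) = taut λ v →
  forall₂ (λ a b → not (not a ∨ b) ∨
             (not (not (not a ∨ false) ∨ false) ∨ (not (not b ∨ false) ∨ false)))
    refl (evalL v (⌈ A ⌉ pos U)) (evalL v (⌈ B ⌉ neg U))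

dne-axiom : ∀ A → LAx (((A ⇒ₗ ⊥ₗ) ⇒ₗ ⊥ₗ) ⇒ₗ A)
dne-axiom A = taut λ v → forall₁ (λ a → not (not (not a ∨ false) ∨ false) ∨ a) refl (evalL v A)

modalₗ : Modality → Tm → LFm → LFm
modalₗ box s A = s ∶ A
modalₗ ver s A = Vₗ A

modalₗ-app : ∀ m {s u A B} → LAx (modalₗ m s (A ⇒ₗ B) ⇒ₗ (modalₗ m u A ⇒ₗ modalₗ m (s · u) B))
modalₗ-app box = axApp
modalₗ-app ver = axVK

-- A theorem `q ∶ A` gives `! q` as a proof of it. The term is chosen before `Γ` and `A`.
modalₗ-nec : ∀ m q → ∃ λ t → ∀ {Γ A} → LPV⊢ (q ∶ A) → Γ ⊢ t ∶ modalₗ m q A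
modalₗ-nec box q = _ , λ d → weaken (mp (ax axBang) d)
modalₗ-nec ver q = _ , λ d → axiomΓ axV ∙ weaken (mp (ax axBang) d)

transfer-modalₗ : ∀ {m φ ψ} → Transfer m φ ψ → ∃ λ s → ∃ λ t →
  ∀ U {Γ} → signed U φ ∈ Γ → Γ ⊢ t ∶ modalₗ m s (signed U ψ)
transfer-modalₗ {box} keep = (! pvar 0) , _ , λ U φ∈ → axiomΓ axBang ∙ hyp φ∈
transfer-modalₗ {ver} keep = (! pvar 0) , _ , λ U φ∈ → axiomΓ axV ∙ (axiomΓ (axBang {pvar 0}) ∙ hyp φ∈)
-- `V` carries no term, so `c` is a placeholder.
transfer-modalₗ unwrap     = c , _ , λ U φ∈ → hyp φ∈

-- Distributes the modality over the implication and detaches the hypotheses one by one; `s`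
-- collects the terms of their modal versions.
discharge : ∀ {m S S′} → All (TransferredFrom m S) S′ → ∀ q t → ∃ λ s → ∃ λ t′ →
  ∀ U {B} → map (signed U) S ⊢ t ∶ modalₗ m q (map (signed U) S′ ⟶ B) →
  map (signed U) S ⊢ t′ ∶ modalₗ m s B
discharge [] q t = q , t , λ U d → d
discharge {m} ((φ , φ∈ , τ) ∷ from) q t =
  let u , _ , arg   = transfer-modalₗ τ
      s , _ , rest  = discharge from q t
  in s · u , _ , λ U d → axiomΓ (modalₗ-app m) ∙ rest U d ∙ arg U (∈-map⁺ (signed U) φ∈)

-- The inclusion of a summand is used inside internalised reasoning, so it needs a proof term, one
-- `w` for all `A`.
record Embeds (w s U : Tm) : Set where
  constructor embeds
  field at : ∀ A → LPV⊢ (w ∶ (s ∶ A ⇒ₗ U ∶ A))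
open Embeds

-- The composite witness is the same for both summands.
inSum : Tm → Tm
inSum w = c · c · w

syllogism : ∀ {t s A B C} → LPV⊢ (t ∶ (A ⇒ₗ B)) → LPV⊢ (s ∶ (B ⇒ₗ C)) →
  LPV⊢ ((c · t · s) ∶ (A ⇒ₗ C))
syllogism {A = A} {B} {C} d e = app (app (axnec 0 (taut composes)) d) e
  where
  composes : TautL ((A ⇒ₗ B) ⇒ₗ ((B ⇒ₗ C) ⇒ₗ (A ⇒ₗ C)))
  composes v = ∨-not⁺ (evalL v (A ⇒ₗ B)) λ f → ∨-not⁺ (evalL v (B ⇒ₗ C)) λ g →
    ∨-not⁺ (evalL v A) λ a → ∨-not⁻ (evalL v B) g (∨-not⁻ (evalL v A) f a)

Embeds-+ˡ : ∀ {w s t U} → Embeds w (s +ₜ t) U → Embeds (inSum w) s U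
Embeds-+ˡ e = embeds λ A → syllogism (axnec 0 axSumR) (at e A)

Embeds-+ʳ : ∀ {w s t U} → Embeds w (s +ₜ t) U → Embeds (inSum w) t U
Embeds-+ʳ e = embeds λ A → syllogism (axnec 0 axSumL) (at e A)

modalₗ-embed : ∀ m A s w → ∃ λ t → ∀ U {Γ} → Embeds w s U →
  Γ ⊢ t ∶ (modalₗ m s (⌈ A ⌉ pos U) ⇒ₗ ⌈ mod m A ⌉ pos U)
modalₗ-embed box A s w = _ , λ _ e → weaken (at e _)
modalₗ-embed ver A s w = _ , λ _ _ → axiomΓ (taut (λ v → ∨-not⁺ (v _) (λ a → a)))

-- The internalised derivation t uses that W is a summand of U, so the proof w of
-- this fact must be known before t; W, a sum of terms like t, and U come last.
Realised : Tm → List SFm → Set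
Realised w S = ∃ λ W → ∃ λ t → ∀ U → Embeds w W U → map (signed U) S ⊢ t ∶ ⊥ₗ

realised : ∀ {S} → Closed S → ∀ w → Realised w S
realised (init T∈ F∈) w = c , _ , λ U _ → hyp (∈-map⁺ (signed U) F∈) ∙ hyp (∈-map⁺ (signed U) T∈)
realised (bot T∈) w = c , _ , λ U _ → hyp (∈-map⁺ (signed U) T∈)
realised (alpha a φ∈ d) w =
  let W , _ , p = realised d w
  in W , _ , λ U e → deduction (p U e) ∙ (axiomΓ (alpha-axiom U a) ∙ hyp (∈-map⁺ (signed U) φ∈))
realised (beta b φ∈ d d′) w =
  let W  , _ , p  = realised d  (inSum w)
      W′ , _ , p′ = realised d′ (inSum w)
  in W +ₜ W′ , _ , λ U e →
     axiomΓ (beta-axiom U b) ∙ hyp (∈-map⁺ (signed U) φ∈) ∙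
       deduction (p U (Embeds-+ˡ e)) ∙ deduction (p′ U (Embeds-+ʳ e))
realised (modal {A} m F∈ from d) w =
  let W , t , p     = realised d (inSum w)
      -- The term of `axiomΓ (dne-axiom _) ∙ deduction …` below, which turns the refutation of `F A`
      -- into a proof of `A` from `S′`.
      q             = c · (c · c) · t
      u , necessary = modalₗ-nec m q
      s , _ , boxed = discharge from q u
      _ , embed     = modalₗ-embed m A s (inSum w)
  in W +ₜ s , _ , λ U e →
     hyp (∈-map⁺ (signed U) F∈) ∙
       (embed U (Embeds-+ʳ e) ∙
        boxed U (necessary (theorem (axiomΓ (dne-axiom _) ∙ deduction (p U (Embeds-+ˡ e))))))

theorem6 : (F : Fm) → S4V⊢ F → Σ (Realisation F) (λ r → Normal r × LPV⊢ (F ^ r))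
theorem6 A d =
  -- `U` is the collected sum itself, so its embedding is the tautology `U ∶ B ⇒ₗ U ∶ B`, whose
  -- proof term is `c`.
  let U , _ , p = realised (cut-free d) c
      identity  = embeds λ B → axnec 0 (taut λ v → ∨-not⁺ (v (U ∶ B)) (λ b → b))
  in realise U pos A , realise-normal U pos A ,
     mp (ax (dne-axiom _)) (mp (ax axRefl) (theorem (p U identity)))
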